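{- For every finite integer $t\ge 1$ and every $s\ge 1$ ($s\in\mathbb N\cup\{\infty\}$), no deterministic online algorithm for $\mathrm{OMP}_3(s,t)$ has competitive ratio larger than $$\gamma_t:=\frac{2\cdot 2^t-1}{3\cdot 2^t-1}.$$
   Context: Online bipartite matching: an instance $(G,\pi)$ is a finite bipartite graph $G=(L,R,E)$ and an arrival order $\pi$ of $R$. The offline side $L$ is known in advance; online vertices $j\in R$ arrive one by one in order $\pi$, and upon arrival of $j$ all edges incident to $j$ are revealed. The algorithm maintains a matching $M$, initially empty. A vertex is free if it is currently unmatched. $\mathrm{OMP}_3(s,t)$ for $s,t\in\mathbb N\cup\{\infty\}$: upon arrival of $j$, the algorithm either leaves $j$ unmatched (forever, unless matched at this moment) or augments the current matching along an augmenting path of length $1$ or $3$ that starts at $j$ and ends at a free vertex of $L$. A length-1 path $[j~i]$ adds $ji$ with $i\in L$ free. A length-3 path $[j~x~y~i]$, with $x,i\in L$, $y\in R$, $xy\in M$, $i$ free, $jx,yi\in E$, replaces $M$ by $(M\setminus\{xy\})\cup\{jx,yi\}$; then $x$ and $y$ are each said to be reassigned once. Over the execution, each vertex of $L$ may be reassigned at most $s$ times and each vertex of $R$ at most $t$ times. A deterministic algorithm may decide arbitrarily (as a function of what has been revealed so far) among the permitted moves, including leaving $j$ unmatched. A deterministic online algorithm $\mathcal A$ is $\rho$-competitive if for every instance $(G,\pi)$ its output matching has size at least $\rho\cdot\nu(G)$, where $\nu(G)$ is the maximum size of a matching in $G$. The competitive ratio of $\mathcal A$ is the largest such $\rho$ (supremum).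 -}

module Defs where

open import Data.Fin using (Fin; zero; suc)
open import Data.Fin.Permutation using (Permutation′; _⟨$⟩ʳ_)
open import Data.Fin.Subset using (Subset; _∈_; ∣_∣)
open import Data.Integer using (+_)
open import Data.Maybe using (Maybe; just; nothing; is-just)
import Data.Maybe as Maybe
open import Data.Nat using (ℕ; suc; _*_; _∸_; _^_; _≤_; NonZero; >-nonZero)
open import Data.Nat.Properties using (*-mono-≤; m^n>0; m<n⇒0<n∸m; n≤1+n)
open import Data.Product using (∃-syntax; _×_)
open import Data.Rational using (ℚ; _/_)
import Data.Rational as ℚ
open import Data.Unit using (⊤)
open import Data.Vec using (Vec; []; _∷_; lookup; map; replicate; reverse; tabulate; _[_]≔_; _[_]%=_)
open import Relation.Binary.PropositionalEquality using (_≡_)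
open import Relation.Nullary.Construct.Add.Supremum using (_⁺; [_])

open import Relation.Binary.Construct.Add.Supremum.NonStrict _≤_ public using (_≤⁺_)

private variable
  n m : ℕ

ℕ∞ : Set
ℕ∞ = ℕ ⁺

fin : ℕ → ℕ∞
fin k = [ k ]

------------------------------------------------------------------------
-- Bipartite graphs and matchings

record BipartiteGraph : Set where
  field
    ∣L∣ ∣R∣ : ℕ
    nbrs    : Fin ∣R∣ → Subset ∣L∣

-- A set of edges in which every offline vertex lies in at most one edge:
-- each offline vertex carries its partner, if any.
Pairing : ℕ → ℕ → Set
Pairing n m = Vec (Maybe (Fin m)) n

size : Pairing n m → ℕ
size M = ∣ map is-just M ∣

module _ (G : BipartiteGraph) where
  open BipartiteGraph G

  IsMatching : Pairing ∣L∣ ∣R∣ → Set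
  IsMatching M =
      (∀ i j → lookup M i ≡ just j → i ∈ nbrs j)
    × (∀ i i′ j → lookup M i ≡ just j → lookup M i′ ≡ just j → i ≡ i′)

  -- ν(G) = k
  IsMatchingNumber : ℕ → Set
  IsMatchingNumber k =
      (∃[ M ] IsMatching M × size M ≡ k)
    × (∀ M → IsMatching M → size M ≤ k)

record Instance : Set where
  field
    G : BipartiteGraph
  open BipartiteGraph G public
  field
    -- π ⟨$⟩ʳ k is the k-th online vertex to arrive.
    π : Permutation′ ∣R∣

------------------------------------------------------------------------
-- Executions

-- The neighbourhoods of the m online vertices that have arrived, latest
-- first.  During an execution an online vertex is addressed by its index
-- in this vector, so that each arrival shifts the earlier vertices by suc.
History : ℕ → ℕ → Set
History n m = Vec (Subset n) m

revealed : (I : Instance) → History (Instance.∣L∣ I) (Instance.∣R∣ I)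
revealed I = reverse (tabulate (λ k → nbrs (π ⟨$⟩ʳ k)))
  where open Instance I

record State (n m : ℕ) : Set where
  field
    matching    : Pairing n m
    reassignedL : Vec ℕ n
    reassignedR : Vec ℕ m

open State public

-- Moves for a new online vertex j, when m online vertices came before it.
data Move (n m : ℕ) : Set where
  skip  : Move n m
  path₁ : (i : Fin n) → Move n m                            -- [ j i ]
  path₃ : (x : Fin n) (y : Fin m) (i : Fin n) → Move n m    -- [ j x y i ]

Free : State n m → Fin n → Set
Free S i = lookup (matching S) i ≡ nothing

-- Here N is the neighbourhood of j.
IsAugmenting : Subset n → History n m → State n m → Move n m → Set
IsAugmenting N h S skip          = ⊤
IsAugmenting N h S (path₁ i)     = i ∈ N × Free S i
IsAugmenting N h S (path₃ x y i) =
  x ∈ N × lookup (matching S) x ≡ just y × i ∈ lookup h y × Free S i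

initial : State n 0
initial = record
  { matching    = replicate _ nothing
  ; reassignedL = replicate _ 0
  ; reassignedR = []
  }

apply : Move n m → State n m → State n (suc m)
apply {n} {m} move S = go move
  where
  M : Pairing n (suc m)
  M = map (Maybe.map suc) (matching S)

  go : Move n m → State n (suc m)
  go skip = record
    { matching    = M
    ; reassignedL = reassignedL S
    ; reassignedR = 0 ∷ reassignedR S
    }
  go (path₁ i) = record
    { matching    = M [ i ]≔ just zero
    ; reassignedL = reassignedL S
    ; reassignedR = 0 ∷ reassignedR S
    }
  go (path₃ x y i) = record
    { matching    = M [ x ]≔ just zero [ i ]≔ just (suc y)
    ; reassignedL = reassignedL S [ x ]%= suc
    ; reassignedR = 0 ∷ (reassignedR S [ y ]%= suc)
    }

-- The head of the history is the vertex that has just arrived.  The current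
-- matching is not an argument because it is determined by the history.
Strategy : Set
Strategy = ∀ {n m} → History n (suc m) → Move n m

run : Strategy → History n m → State n m
run σ []      = initial
run σ (N ∷ h) = apply (σ (N ∷ h)) (run σ h)

record OMP₃ (s t : ℕ∞) : Set where
  field
    strategy   : Strategy
    augmenting : ∀ {n m} (N : Subset n) (h : History n m) →
                 IsAugmenting N h (run strategy h) (strategy (N ∷ h))
    budgetL    : ∀ {n m} (h : History n m) (i : Fin n) →
                 fin (lookup (reassignedL (run strategy h)) i) ≤⁺ s
    budgetR    : ∀ {n m} (h : History n m) (j : Fin m) →
                 fin (lookup (reassignedR (run strategy h)) j) ≤⁺ t

------------------------------------------------------------------------
-- Competitiveness

fromℕ : ℕ → ℚ
fromℕ k = + k / 1

module _ {s t : ℕ∞} (A : OMP₃ s t) where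

  outputSize : Instance → ℕ
  outputSize I = size (matching (run (OMP₃.strategy A) (revealed I)))

  Competitive : ℚ → Set
  Competitive ρ = ∀ (I : Instance) k → IsMatchingNumber (Instance.G I) k →
                  ρ ℚ.* fromℕ k ℚ.≤ fromℕ (outputSize I)

  -- The competitive ratio is the supremum of a downward closed set of reals,
  -- so it exceeds q exactly when some rational above q belongs to that set.
  CompetitiveRatioExceeds : ℚ → Set
  CompetitiveRatioExceeds q = ∃[ ρ ] q ℚ.< ρ × Competitive ρ

γ : ℕ → ℚ
γ t = + (2 * 2 ^ t ∸ 1) / (3 * 2 ^ t ∸ 1)
  where instance
  denominator≢0 : NonZero (3 * 2 ^ t ∸ 1)
  denominator≢0 =
    >-nonZero (m<n⇒0<n∸m (*-mono-≤ {2} {3} (n≤1+n 2) (m^n>0 2 t)))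

{-# OPTIONS --safe #-}

-- The adversary splits L into blocks of t + 2 vertices and presents one online
-- vertex per block, adjacent to all of it.  Such a vertex y is live, at level
-- the number of its reassignments, as long as a partner for it in a reference
-- matching W has not been fixed.  While there are more than t + 1 live vertices,
-- two of them, y₁ matched to x₁ and y₂ matched to x₂, have the same level k, and
-- a vertex j with neighbours x₁ and x₂ arrives.
--   If j is skipped, W gains j x₁ and y₁ i with i an untouched vertex of the
-- block of y₁, and y₁ is no longer live.
--   Otherwise j displaces, say, y₁ from x₁ and y₁ rises to level k + 1.  A vertex
-- j′ adjacent to x₁ only arrives and cannot be matched.  W gains j′ x₁, j x₂
-- and y₂ i with i an untouched vertex of the block of y₂, and y₂ is no longer
-- live.
-- With α = 3·2^t − 1, β = 2·2^t − 1 and φ k = 2^k + 3·2^t − 2, the algorithm's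
-- matching M satisfies α |M| ≤ β |W| + Σ φ (level of y) over the live y at all
-- times.  At the end at most t + 1 vertices are live, so the sum is bounded
-- independently of the number of blocks, while |W| is not.

module Submission where

open import Defs
open import Data.Nat using (ℕ; zero; suc; _+_; _*_; _∸_; _^_; _≤_; _<_; z≤n; s≤s; NonZero; >-nonZero)
open import Data.Nat.Properties
open import Data.Nat.ListAction using (sum)
open import Data.Nat.ListAction.Properties using (sum-↭)
open import Data.Nat.Tactic.RingSolver using (solve-∀)
open import Data.Fin as Fin using (Fin; zero; suc; toℕ; fromℕ<; quotient; combine; opposite)
import Data.Fin.Properties as Fin
import Data.Fin.Permutation as Permutation
open import Data.Fin.Subset using (Subset; _∈_; ⁅_⁆; _∪_; ∣_∣)
open import Data.Fin.Subset.Properties using (x∈⁅x⁆; x∈⁅y⁆⇒x≡y; x∈p∪q⁻; x∈p∪q⁺; ∣p∣≤n; ∣⊥∣≡0)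
open import Data.List as List using (List; []; _∷_; length)
open import Data.List.Properties using (length-map; map-∘)
open import Data.List.Membership.Propositional using () renaming (_∈_ to _∈ₗ_; _∉_ to _∉ₗ_)
open import Data.List.Membership.Propositional.Properties using (∈-lookup)
open import Data.List.Membership.DecPropositional using () renaming (_∈?_ to mem?)
open import Data.List.Relation.Unary.Any as Any using (here; there)
open import Data.List.Relation.Unary.Any.Properties using (lookup-index)
open import Data.List.Relation.Unary.All as All using (All; []; _∷_)
import Data.List.Relation.Unary.All.Properties as All
open import Data.List.Relation.Unary.AllPairs as AllPairs using (AllPairs; []; _∷_)
import Data.List.Relation.Unary.AllPairs.Properties as AllPairs
open import Data.List.Relation.Binary.Permutation.Propositional as Perm using (_↭_; ↭-refl; ↭-trans; prep; swap)
import Data.List.Relation.Binary.Permutation.Propositional.Properties as Perm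
open import Data.Integer as ℤ using (+_; -[1+_])
import Data.Integer.Properties as ℤ
open import Data.Rational as ℚ using (ℚ; mkℚ; toℚᵘ)
import Data.Rational.Properties as ℚ
open import Data.Rational.Unnormalised as ℚᵘ using (mkℚᵘ)
import Data.Rational.Unnormalised.Properties as ℚᵘ
open import Data.Maybe as Maybe using (Maybe; just; nothing; is-just)
open import Data.Maybe.Properties using (just-injective)
open import Data.Product using (∃; ∃₂; ∃-syntax; _×_; _,_; proj₁; proj₂)
open import Data.Sum as Sum using (_⊎_; inj₁; inj₂)
open import Data.Vec as Vec using (Vec; []; _∷_; lookup; tabulate; reverse; _[_]≔_)
open import Data.Vec.Properties
  using (lookup-map; lookup∘update; lookup∘update′; lookup∘updateAt; lookup∘updateAt′;
         lookup∘tabulate; lookup⇒[]=; []=⇒lookup; lookup-replicate; map-replicate; reverse-involutive;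
         reverse-∷; tabulate-cong)
open import Relation.Binary.PropositionalEquality
open import Relation.Nullary using (¬_; yes; no; does; contradiction)
open import Relation.Nullary.Decidable using (dec-true; ¬?)
open import Function using (_∘_; case_of_)
open import Relation.Binary.Construct.Add.Supremum.NonStrict _≤_ using ([≤]-injective)

private variable
  n m : ℕ
  A : Set

-- Pairings under arrivals and insertions of edges.

graph : History n m → BipartiteGraph
graph h = record { nbrs = lookup h }

Unmatched : Pairing n m → Fin m → Set
Unmatched P j = ∀ i → lookup P i ≢ just j

-- The same map as the local `M` of `apply`, so `matching (apply skip S)` is `weaken (matching S)`
-- by computation.
weaken : Pairing n m → Pairing n (suc m)
weaken = Vec.map (Maybe.map suc)

module _ (P : Pairing n m) where

  weaken-just : ∀ {i j} → lookup P i ≡ just j → lookup (weaken P) i ≡ just (suc j)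
  weaken-just {i} eq = trans (lookup-map i _ P) (cong (Maybe.map suc) eq)

  weaken-nothing : ∀ {i} → lookup P i ≡ nothing → lookup (weaken P) i ≡ nothing
  weaken-nothing {i} eq = trans (lookup-map i _ P) (cong (Maybe.map suc) eq)

  weaken-nothing⁻ : ∀ {i} → lookup (weaken P) i ≡ nothing → lookup P i ≡ nothing
  weaken-nothing⁻ {i} eq with lookup P i | lookup-map i (Maybe.map Fin.suc) P
  ... | nothing | _   = refl
  ... | just _  | eq′ = case trans (sym eq) eq′ of λ ()

  weaken-just⁻ : ∀ {i j} → lookup (weaken P) i ≡ just j →
                 ∃ λ k → j ≡ suc k × lookup P i ≡ just k
  weaken-just⁻ {i} eq with lookup P i | lookup-map i (Maybe.map Fin.suc) P
  ... | nothing | eq′ = case trans (sym eq) eq′ of λ ()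
  ... | just k  | eq′ = k , just-injective (trans (sym eq) eq′) , refl

  weaken-zero-unmatched : Unmatched (weaken P) zero
  weaken-zero-unmatched i eq with weaken-just⁻ eq
  ... | _ , () , _

  weaken-unmatched : ∀ {j} → Unmatched P j → Unmatched (weaken P) (suc j)
  weaken-unmatched un i eq with weaken-just⁻ eq
  ... | _ , refl , eq′ = un i eq′

weaken-size : (P : Pairing n m) → size (weaken P) ≡ size P
weaken-size []            = refl
weaken-size (nothing ∷ P) = weaken-size P
weaken-size (just _ ∷ P)  = cong suc (weaken-size P)

insert-size : ∀ (P : Pairing n m) i {j} → lookup P i ≡ nothing →
              size (P [ i ]≔ just j) ≡ suc (size P)
insert-size (nothing ∷ P) zero    eq = refl
insert-size (nothing ∷ P) (suc i) eq = insert-size P i eq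
insert-size (just _ ∷ P)  (suc i) eq = cong suc (insert-size P i eq)

overwrite-size : ∀ (P : Pairing n m) i {j k} → lookup P i ≡ just k →
                 size (P [ i ]≔ just j) ≡ size P
overwrite-size (just _ ∷ P)  zero    eq = refl
overwrite-size (nothing ∷ P) (suc i) eq = overwrite-size P i eq
overwrite-size (just _ ∷ P)  (suc i) eq = cong suc (overwrite-size P i eq)

insert-just⁻ : ∀ (P : Pairing n m) i {i′ j k} → lookup (P [ i ]≔ just j) i′ ≡ just k →
               (i ≡ i′ × j ≡ k) ⊎ (i ≢ i′ × lookup P i′ ≡ just k)
insert-just⁻ P i {i′} {j} eq with i Fin.≟ i′
... | yes refl = inj₁ (refl , just-injective (trans (sym (lookup∘update i P (just j))) eq))
... | no  i≢i′ = inj₂ (i≢i′ , trans (sym (lookup∘update′ (i≢i′ ∘ sym) P (just j))) eq)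

insert-unmatched : ∀ (P : Pairing n m) {i j k} → Unmatched P j → k ≢ j → Unmatched (P [ i ]≔ just k) j
insert-unmatched P {i} un k≢j i′ eq with insert-just⁻ P i eq
... | inj₁ (_ , k≡j) = k≢j k≡j
... | inj₂ (_ , eq′) = un i′ eq′

weaken-isMatching : ∀ N (h : History n m) P → IsMatching (graph h) P →
                    IsMatching (graph (N ∷ h)) (weaken P)
weaken-isMatching N h P (edge , inj) = edge′ , inj′
  where
  edge′ : ∀ i j → lookup (weaken P) i ≡ just j → i ∈ lookup (N ∷ h) j
  edge′ i j eq with weaken-just⁻ P eq
  ... | k , refl , eq′ = edge i k eq′
  inj′ : ∀ i i′ j → lookup (weaken P) i ≡ just j → lookup (weaken P) i′ ≡ just j → i ≡ i′
  inj′ i i′ j eq₁ eq₂ with weaken-just⁻ P eq₁ | weaken-just⁻ P eq₂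
  ... | k , refl , eq₁′ | .k , refl , eq₂′ = inj i i′ k eq₁′ eq₂′

insert-isMatching : ∀ (h : History n m) P {i j} → IsMatching (graph h) P →
                    Unmatched P j → i ∈ lookup h j →
                    IsMatching (graph h) (P [ i ]≔ just j)
insert-isMatching h P {i} {j} (edge , inj) un i∈j = edge′ , inj′
  where
  edge′ : ∀ i′ k → lookup (P [ i ]≔ just j) i′ ≡ just k → i′ ∈ lookup h k
  edge′ i′ k eq with insert-just⁻ P i eq
  ... | inj₁ (refl , refl) = i∈j
  ... | inj₂ (_ , eq′)     = edge i′ k eq′
  inj′ : ∀ i₁ i₂ k → lookup (P [ i ]≔ just j) i₁ ≡ just k →
         lookup (P [ i ]≔ just j) i₂ ≡ just k → i₁ ≡ i₂
  inj′ i₁ i₂ k eq₁ eq₂ with insert-just⁻ P i eq₁ | insert-just⁻ P i eq₂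
  ... | inj₁ (refl , refl) | inj₁ (refl , _)    = refl
  ... | inj₁ (refl , refl) | inj₂ (_ , eq₂′)    = contradiction eq₂′ (un i₂)
  ... | inj₂ (_ , eq₁′)    | inj₁ (refl , refl) = contradiction eq₁′ (un i₁)
  ... | inj₂ (_ , eq₁′)    | inj₂ (_ , eq₂′)    = inj i₁ i₂ k eq₁′ eq₂′

-- Finite combinatorics

-- If every value of `f` occurred in `xs`, its position there would give an injection from `Fin k`
-- into `Fin (length xs)`.
avoid : ∀ {k} (f : Fin k → Fin n) → (∀ {i j} → f i ≡ f j → i ≡ j) →
        (xs : List (Fin n)) → length xs < k → ∃ λ r → f r ∉ₗ xs
avoid f f-inj xs ∣xs∣<k with Fin.any? (λ r → ¬? (mem? Fin._≟_ (f r) xs))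
... | yes found = found
... | no  none  = contradiction ∣xs∣<k (≤⇒≯ (Fin.injective⇒≤ {f = Any.index ∘ in-xs} index-inj))
  where
  in-xs : ∀ r → f r ∈ₗ xs
  in-xs r with mem? Fin._≟_ (f r) xs
  ... | yes p = p
  ... | no ¬p = contradiction (r , ¬p) none
  index-inj : ∀ {i j} → Any.index (in-xs i) ≡ Any.index (in-xs j) → i ≡ j
  index-inj {i} {j} eq = f-inj (trans (lookup-index (in-xs i))
    (trans (cong (List.lookup xs) eq) (sym (lookup-index (in-xs j)))))

↭-lookup : (xs : List A) (i : Fin (length xs)) → ∃ λ rest → xs ↭ List.lookup xs i ∷ rest
↭-lookup (x ∷ xs) zero    = xs , ↭-refl
↭-lookup (x ∷ xs) (suc i) with ↭-lookup xs i
... | rest , p = x ∷ rest , ↭-trans (prep x p) (swap _ _ ↭-refl)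

↭-lookup₂ : (xs : List A) {i j : Fin (length xs)} → i Fin.< j →
            ∃ λ rest → xs ↭ List.lookup xs i ∷ List.lookup xs j ∷ rest
↭-lookup₂ (x ∷ xs) {zero} {suc j} _ with ↭-lookup xs j
... | rest , p = rest , prep x p
↭-lookup₂ (x ∷ xs) {suc i} {suc j} (s≤s i<j) with ↭-lookup₂ xs i<j
... | rest , p = x ∷ rest ,
  ↭-trans (prep x p) (↭-trans (swap _ _ ↭-refl) (prep _ (swap _ _ ↭-refl)))

-- The permutation records that the two entries stand at different positions and keeps hold of all
-- the others.
pigeonhole-↭ : ∀ {k} (f : A → ℕ) (xs : List A) → All ((_< k) ∘ f) xs → k < length xs →
               ∃ λ a → ∃ λ b → ∃ λ rest → xs ↭ a ∷ b ∷ rest × f a ≡ f b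
pigeonhole-↭ f xs bounded k<∣xs∣
  with Fin.pigeonhole k<∣xs∣ (λ i → fromℕ< (All.lookup bounded (∈-lookup i)))
... | i , j , i<j , eq with ↭-lookup₂ xs i<j
... | rest , p = _ , _ , rest , p , Fin.fromℕ<-injective _ _ _ _ eq

-- The adversary

module Potential (t : ℕ) where

  -- Written in terms of `2 ^ t ∸ 1`, so that the identities below are polynomial in it and free of
  -- any other truncated subtraction.
  α β : ℕ
  α = 3 * (2 ^ t ∸ 1) + 2
  β = 2 * (2 ^ t ∸ 1) + 1

  φ : ℕ → ℕ
  φ k = 2 ^ k + (3 * (2 ^ t ∸ 1) + 1)

  1+[2^t∸1]≡2^t : suc (2 ^ t ∸ 1) ≡ 2 ^ t
  1+[2^t∸1]≡2^t = m+[n∸m]≡n (m^n>0 2 t)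

  -- A vertex that becomes live enters at level 0, and its weight pays exactly for the edge that M
  -- gains.
  φ0≡α : φ 0 ≡ α
  φ0≡α = lemma (2 ^ t ∸ 1)
    where
    lemma : ∀ τ → 1 + (3 * τ + 1) ≡ 3 * τ + 2
    lemma = solve-∀

  -- Retirement after a skip gives W two edges, worth 2β, in exchange for the weight of the vertex.
  -- That weight grows with the level and reaches exactly 2β at level t.
  φ≤2β : ∀ {k} → k ≤ t → φ k ≤ β * 2
  φ≤2β {k} k≤t = begin
    2 ^ k + (3 * τ + 1)   ≤⟨ +-monoˡ-≤ (3 * τ + 1) (^-monoʳ-≤ 2 k≤t) ⟩
    2 ^ t + (3 * τ + 1)   ≡⟨ cong (_+ (3 * τ + 1)) 1+[2^t∸1]≡2^t ⟨
    suc τ + (3 * τ + 1)   ≡⟨ lemma τ ⟩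
    β * 2                 ∎
    where
    open ≤-Reasoning
    τ = 2 ^ t ∸ 1
    lemma : ∀ τ → suc τ + (3 * τ + 1) ≡ (2 * τ + 1) * 2
    lemma = solve-∀

  skip-potential : ∀ {k μ w r} → k ≤ t → α * μ ≤ β * w + (φ k + r) → α * μ ≤ β * (2 + w) + r
  skip-potential {k} {μ} {w} {r} k≤t p = begin
    α * μ                 ≤⟨ p ⟩
    β * w + (φ k + r)     ≤⟨ +-monoʳ-≤ (β * w) (+-monoˡ-≤ r (φ≤2β k≤t)) ⟩
    β * w + (β * 2 + r)   ≡⟨ lemma β w r ⟩
    β * (2 + w) + r       ∎
    where
    open ≤-Reasoning
    lemma : ∀ β w r → β * w + (β * 2 + r) ≡ β * (2 + w) + r
    lemma = solve-∀

  -- φ is chosen to satisfy α + 2 φ k ≡ 3 β + φ (1 + k).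
  move-potential : ∀ {k μ w r} → α * μ ≤ β * w + (φ k + (φ k + r)) →
                   α * suc μ ≤ β * (3 + w) + (φ (suc k) + r)
  move-potential {k} {μ} {w} {r} p = begin
    α * suc μ                             ≡⟨ *-suc α μ ⟩
    α + α * μ                             ≤⟨ +-monoʳ-≤ α p ⟩
    α + (β * w + (φ k + (φ k + r)))       ≡⟨ lemma (2 ^ t ∸ 1) (2 ^ k) w r ⟩
    β * (3 + w) + (φ (suc k) + r)         ∎
    where
    open ≤-Reasoning
    lemma : ∀ τ p w r →
      (3 * τ + 2) + ((2 * τ + 1) * w + ((p + (3 * τ + 1)) + ((p + (3 * τ + 1)) + r)))
      ≡ (2 * τ + 1) * (3 + w) + ((2 * p + (3 * τ + 1)) + r)
    lemma = solve-∀

-- Blocks and live online vertices.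

module Blocks (t B : ℕ) where
  open Potential t

  width V : ℕ
  width = 2 + t
  V     = B * width

  blk : Fin V → Fin B
  blk = quotient {B} width

  block : Fin B → Subset V
  block b = tabulate (λ i → does (blk i Fin.≟ b))

  blk-combine : ∀ b r → blk (combine {B} {width} b r) ≡ b
  blk-combine b r = cong proj₁ (Fin.remQuot-combine {B} {width} b r)

  ∈-block⁺ : ∀ {i b} → blk i ≡ b → i ∈ block b
  ∈-block⁺ {i} {b} eq =
    lookup⇒[]= i _ (trans (lookup∘tabulate _ i) (dec-true (blk i Fin.≟ b) eq))

  ∈-block⁻ : ∀ {i b} → i ∈ block b → blk i ≡ b
  ∈-block⁻ {i} {b} i∈b
    with blk i Fin.≟ b
       | trans (sym (lookup∘tabulate (λ i → does (blk i Fin.≟ b)) i)) ([]=⇒lookup i∈b)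
  ... | yes eq | _  = eq
  ... | no  _  | ()

  -- An online vertex y that arrived adjacent to a whole block and whose fate in
  -- the reference matching is still open: y is matched to home, after it was
  -- moved away from each vertex in used.
  record Live (m : ℕ) : Set where
    constructor live
    field
      index  : Fin B
      used   : List (Fin V)
      home   : Fin V
      vertex : Fin m

  open Live

  level : Live m → ℕ
  level l = length (used l)

  shift : Live m → Live (suc m)
  shift (live b U x y) = live b U x (suc y)

  record Valid (h : History V m) (S : State V m) (W : Pairing V m) (l : Live m) : Set where
    field
      nbrs⁻     : ∀ {i} → i ∈ lookup h (vertex l) → blk i ≡ index l
      nbrs⁺     : ∀ {i} → blk i ≡ index l → i ∈ lookup h (vertex l)
      matched   : lookup (matching S) (home l) ≡ just (vertex l)
      moves     : lookup (reassignedR S) (vertex l) ≡ level l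
      blk-home  : blk (home l) ≡ index l
      vertex∉W  : Unmatched W (vertex l)
      home∉W    : lookup W (home l) ≡ nothing
      unused    : ∀ {i} → blk i ≡ index l → i ∉ₗ home l ∷ used l → lookup (matching S) i ≡ nothing
      W⊆M       : ∀ {i} → blk i ≡ index l → lookup (matching S) i ≡ nothing → lookup W i ≡ nothing

  open Valid

  -- `Valid` reads the state only on the block of `l` and at its vertex, so a response that leaves
  -- these alone, up to the index shift, preserves it.
  valid-arrive : ∀ {N} {h : History V m} {S W l} {S′ : State V (suc m)} → Valid h S W l →
                 (∀ {i} → blk i ≡ index l → lookup (matching S′) i ≡ lookup (weaken (matching S)) i) →
                 lookup (reassignedR S′) (suc (vertex l)) ≡ lookup (reassignedR S) (vertex l) →
                 Valid (N ∷ h) S′ (weaken W) (shift l)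
  valid-arrive {S = S} {W} v same-M same-R = record
    { nbrs⁻     = nbrs⁻ v
    ; nbrs⁺     = nbrs⁺ v
    ; matched   = trans (same-M (blk-home v)) (weaken-just (matching S) (matched v))
    ; moves     = trans same-R (moves v)
    ; blk-home  = blk-home v
    ; vertex∉W  = weaken-unmatched W (vertex∉W v)
    ; home∉W    = weaken-nothing W (home∉W v)
    ; unused    = λ i∈b i∉ → trans (same-M i∈b) (weaken-nothing (matching S) (unused v i∈b i∉))
    ; W⊆M       = λ i∈b Mi → weaken-nothing W
        (W⊆M v i∈b (weaken-nothing⁻ (matching S) (trans (sym (same-M i∈b)) Mi)))
    }

  -- An edge of W may enter the block of `l` at a vertex covered by M, because `W⊆M` constrains only
  -- the vertices free in M. This is needed at the vertex that a displaced live vertex has left.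
  valid-insert : ∀ {h : History V m} {S W l i j} → Valid h S W l →
                 (blk i ≡ index l → lookup (matching S) i ≢ nothing) → i ≢ home l → j ≢ vertex l →
                 Valid h S (W [ i ]≔ just j) l
  valid-insert {W = W} v touched i≢home j≢y = record
    { nbrs⁻     = nbrs⁻ v
    ; nbrs⁺     = nbrs⁺ v
    ; matched   = matched v
    ; moves     = moves v
    ; blk-home  = blk-home v
    ; vertex∉W  = insert-unmatched W (vertex∉W v) j≢y
    ; home∉W    = trans (lookup∘update′ (i≢home ∘ sym) W _) (home∉W v)
    ; unused    = unused v
    ; W⊆M       = λ i′∈b Mi′ →
        trans (lookup∘update′ (λ { refl → touched i′∈b Mi′ }) W _) (W⊆M v i′∈b Mi′)
    }

  valid-insert-elsewhere : ∀ {h : History V m} {S W l i j} → Valid h S W l →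
                           blk i ≢ index l → j ≢ vertex l → Valid h S (W [ i ]≔ just j) l
  valid-insert-elsewhere v i∉b j≢y =
    valid-insert v (λ eq → contradiction eq i∉b) (λ { refl → i∉b (blk-home v) }) j≢y

  -- The home of `l` is a neighbour of its vertex, and all neighbours of a live vertex lie in a
  -- single block.
  vertices-distinct : ∀ {h : History V m} {S W l l′} → Valid h S W l → Valid h S W l′ →
                      index l ≢ index l′ → vertex l ≢ vertex l′
  vertices-distinct {h = h} v v′ b≢b′ y≡y′ =
    b≢b′ (trans (sym (blk-home v))
      (nbrs⁻ v′ (subst (λ y → _ ∈ lookup h y) y≡y′ (nbrs⁺ v (blk-home v)))))

  valid-move-elsewhere : ∀ {N} {h : History V m} {S W l x y i} → Valid h S W l →
                         blk x ≢ index l → y ≢ vertex l → blk i ≢ index l →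
                         Valid (N ∷ h) (apply (path₃ x y i) S) (weaken W) (shift l)
  valid-move-elsewhere {S = S} {y = y} v x∉b y≢ i∉b = valid-arrive v
    (λ i′∈b → trans (lookup∘update′ (λ { refl → i∉b i′∈b }) (weaken (matching S) [ _ ]≔ _) _)
                    (lookup∘update′ (λ { refl → x∉b i′∈b }) (weaken (matching S)) _))
    (lookup∘updateAt′ _ _ (y≢ ∘ sym) (reassignedR S))

  moved : Fin V → Live m → Live (suc m)
  moved i (live b U x y) = live b (x ∷ U) i (suc y)

  -- The new home was free in M, hence uncovered by W by `W⊆M`; the old home joins `used`.
  valid-move : ∀ {N} {h : History V m} {S W l i} → Valid h S W l →
               blk i ≡ index l → lookup (matching S) i ≡ nothing →
               Valid (N ∷ h) (apply (path₃ (home l) (vertex l) i) S) (weaken W) (moved i l)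
  valid-move {S = S} {W} {l} {i} v i∈b Mi = record
    { nbrs⁻     = nbrs⁻ v
    ; nbrs⁺     = nbrs⁺ v
    ; matched   = lookup∘update i (weaken (matching S) [ _ ]≔ _) _
    ; moves     = trans (lookup∘updateAt (vertex l) (reassignedR S)) (cong suc (moves v))
    ; blk-home  = i∈b
    ; vertex∉W  = weaken-unmatched W (vertex∉W v)
    ; home∉W    = weaken-nothing W Wi
    ; unused    = λ i′∈b i′∉ → trans
        (same-elsewhere (λ { refl → i′∉ (here refl) }) (λ { refl → i′∉ (there (here refl)) }))
        (weaken-nothing (matching S) (unused v i′∈b (i′∉ ∘ there)))
    ; W⊆M       = λ {i′} i′∈b Mi′ → weaken-nothing W (case i′ Fin.≟ i of λ
        { (yes refl) → Wi
        ; (no i′≢i) → case i′ Fin.≟ home l of λ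
          { (yes refl) → home∉W v
          ; (no i′≢x) → W⊆M v i′∈b
              (weaken-nothing⁻ (matching S) (trans (sym (same-elsewhere i′≢i i′≢x)) Mi′)) } })
    }
    where
    Wi = W⊆M v i∈b Mi
    same-elsewhere : ∀ {i′} → i′ ≢ i → i′ ≢ home l →
      lookup (matching (apply (path₃ (home l) (vertex l) i) S)) i′ ≡ lookup (weaken (matching S)) i′
    same-elsewhere i′≢i i′≢x =
      trans (lookup∘update′ i′≢i (weaken (matching S) [ _ ]≔ _) _)
            (lookup∘update′ i′≢x (weaken (matching S)) _)

  -- The partner must differ from `home`, because W pairs `home` with a newly arrived vertex.
  record Retirement (h : History V m) (W : Pairing V m) (l : Live m) : Set where
    field
      partner   : Fin V
      ∈block    : blk partner ≡ index l
      ≢home     : partner ≢ home l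
      unmatched : lookup W partner ≡ nothing
      matching′ : IsMatching (graph h) (W [ partner ]≔ just (vertex l))

  open Retirement

  -- A block has two vertices more than a vertex of R has moves.
  retire : ∀ {h : History V m} {S W l} → Valid h S W l → level l ≤ t →
           IsMatching (graph h) W → Retirement h W l
  retire {h = h} {W = W} {l} v level≤t isM
    with avoid (combine {B} {width} (index l)) (λ {r} {r′} → Fin.combine-injectiveʳ (index l) r (index l) r′)
               (home l ∷ used l) (s≤s (s≤s level≤t))
  ... | r , ∉ = record
    { partner   = combine (index l) r
    ; ∈block    = blk-combine (index l) r
    ; ≢home     = λ eq → ∉ (here eq)
    ; unmatched = W⊆M v (blk-combine (index l) r) (unused v (blk-combine (index l) r) ∉)
    ; matching′ = insert-isMatching h W isM (vertex∉W v) (nbrs⁺ v (blk-combine (index l) r))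
    }

  -- The invariant, and the two ways of retiring a live vertex.

  Apart : Live m → Live m → Set
  Apart l l′ = index l ≢ index l′

  total : List (Live m) → ℕ
  total ls = sum (List.map (φ ∘ level) ls)

  total-shift : (ls : List (Live m)) → total (List.map shift ls) ≡ total ls
  total-shift ls = cong sum (sym (map-∘ ls))

  record Config (h : History V m) (S : State V m) (W : Pairing V m) (ls : List (Live m)) : Set where
    field
      isMatching : IsMatching (graph h) W
      valid      : All (Valid h S W) ls
      apart      : AllPairs Apart ls
      potential  : α * size (matching S) ≤ β * size W + total ls

  open Config

  -- M does not grow, and the two edges gained by W make up for the weight of the vertex that leaves
  -- the list.
  skip-step : ∀ {N} {h : History V m} {S W l₁ ls} → Config h S W (l₁ ∷ ls) →
              home l₁ ∈ N → level l₁ ≤ t →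
              ∃ λ W′ → Config (N ∷ h) (apply skip S) W′ (List.map shift ls) × size W′ ≡ 2 + size W
  skip-step {N = N} {h} {S} {W} {l₁} {ls} c x∈N level≤t
    with valid c | apart c
  ... | v₁ ∷ vs | ds ∷ apart-ls = W₂ , record
    { isMatching = insert-isMatching (N ∷ h) W₁ (matching′ r)
        (insert-unmatched (weaken W) (weaken-zero-unmatched W) λ ()) x∈N
    ; valid      = All.map⁺ (All.zipWith keep (ds , vs))
    ; apart      = AllPairs.map⁺ apart-ls
    ; potential  = subst₂ (λ μ ρ → α * μ ≤ ρ) (sym (weaken-size (matching S)))
        (cong₂ (λ w ρ → β * w + ρ) (sym size₂) (sym (total-shift ls)))
        (skip-potential level≤t (potential c))
    } , size₂
    where
    skipped : ∀ {l} → Valid h S W l → Valid (N ∷ h) (apply skip S) (weaken W) (shift l)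
    skipped v = valid-arrive v (λ _ → refl) refl
    r  = retire (skipped v₁) level≤t (weaken-isMatching N h W (isMatching c))
    W₁ = weaken W [ partner r ]≔ just (suc (vertex l₁))
    W₂ = W₁ [ home l₁ ]≔ just zero
    size₂ : size W₂ ≡ 2 + size W
    size₂ = trans
      (insert-size W₁ (home l₁)
        (trans (lookup∘update′ (≢home r ∘ sym) (weaken W) _) (weaken-nothing W (home∉W v₁))))
      (cong suc (trans (insert-size (weaken W) (partner r) (unmatched r)) (cong suc (weaken-size W))))
    keep : ∀ {l} → Apart l₁ l × Valid h S W l → Valid (N ∷ h) (apply skip S) W₂ (shift l)
    keep (b≢ , v) = valid-insert-elsewhere
      (valid-insert-elsewhere (skipped v) (b≢ ∘ trans (sym (∈block r)))
        (vertices-distinct v₁ v b≢ ∘ Fin.suc-injective))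
      (b≢ ∘ trans (sym (blk-home v₁))) λ ()

  -- The arrivals of j and j′ form one step, since the balance of the potential counts the edges of
  -- W at j, j′ and the retired vertex together.
  move-step : ∀ {N N′} {h : History V m} {S W l₁ l₂ ls i} → Config h S W (l₁ ∷ l₂ ∷ ls) →
              home l₂ ∈ N → home l₁ ∈ N′ →
              blk i ≡ index l₁ → lookup (matching S) i ≡ nothing →
              level l₁ ≡ level l₂ → level l₂ ≤ t →
              ∃ λ W′ → Config (N′ ∷ N ∷ h) (apply skip (apply (path₃ (home l₁) (vertex l₁) i) S)) W′
                              (shift (moved i l₁) ∷ List.map (shift ∘ shift) ls)
                       × size W′ ≡ 3 + size W
  move-step {N = N} {N′} {h} {S} {W} {l₁} {l₂} {ls} {i} c x₂∈N x₁∈N′ i∈b Mi same-level level≤t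
    with valid c | apart c
  ... | v₁ ∷ v₂ ∷ vs | (b₁≢b₂ ∷ ds₁) ∷ ds₂ ∷ apart-ls = W₃ , record
    { isMatching = insert-isMatching h₂ W₂
        (insert-isMatching h₂ W₁ (matching′ r)
          (insert-unmatched W₀ (weaken-zero-unmatched (weaken W)) λ ()) x₁∈N′)
        (insert-unmatched W₁ (insert-unmatched W₀
          (weaken-unmatched (weaken W) (weaken-zero-unmatched W)) λ ()) λ ())
        x₂∈N
    ; valid      = keep₁ ∷ All.map⁺ (All.zipWith keep (ds₁ , All.zip (ds₂ , vs)))
    ; apart      = All.map⁺ ds₁ ∷ AllPairs.map⁺ apart-ls
    ; potential  = subst₂ (λ μ ρ → α * μ ≤ ρ) (sym size-M)
        (cong₂ (λ w ρ → β * w + (φ (suc (level l₁)) + ρ)) (sym size₃) (cong sum (map-∘ ls)))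
        -- Equal levels let both weights be written as φ at the level of `l₁`.
        (move-potential {level l₁} (subst
          (λ k → α * size (matching S) ≤ β * size W + (φ (level l₁) + (φ k + total ls)))
          (sym same-level) (potential c)))
    } , size₃
    where
    h₂ = N′ ∷ N ∷ h
    S₁ = apply (path₃ (home l₁) (vertex l₁) i) S
    S₂ = apply skip S₁
    W₀ = weaken (weaken W)
    elsewhere : ∀ {l} → Apart l₁ l → Valid h S W l → Valid h₂ S₂ W₀ (shift (shift l))
    elsewhere b≢ v = valid-arrive
      (valid-move-elsewhere v (b≢ ∘ trans (sym (blk-home v₁))) (vertices-distinct v₁ v b≢)
        (b≢ ∘ trans (sym i∈b)))
      (λ _ → refl) refl
    r  = retire (elsewhere b₁≢b₂ v₂) level≤t
      (weaken-isMatching N′ (N ∷ h) (weaken W) (weaken-isMatching N h W (isMatching c)))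
    -- Index `zero` is j′, which takes the home that `l₁` has left; `suc zero` is j, which takes the
    -- home of the retired `l₂`.
    W₁ = W₀ [ partner r ]≔ just (suc (suc (vertex l₂)))
    W₂ = W₁ [ home l₁ ]≔ just zero
    W₃ = W₂ [ home l₂ ]≔ just (suc zero)
    x₁≢i : home l₁ ≢ i
    x₁≢i refl = case trans (sym (matched v₁)) Mi of λ ()
    x₁≢x₂ : home l₁ ≢ home l₂
    x₁≢x₂ eq = b₁≢b₂ (trans (sym (blk-home v₁)) (trans (cong blk eq) (blk-home v₂)))
    x₁≢p : home l₁ ≢ partner r
    x₁≢p eq = b₁≢b₂ (trans (sym (blk-home v₁)) (trans (cong blk eq) (∈block r)))
    W₀-nothing : ∀ {l} → Valid h S W l → lookup W₀ (home l) ≡ nothing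
    W₀-nothing v = weaken-nothing (weaken W) (weaken-nothing W (home∉W v))
    size₃ : size W₃ ≡ 3 + size W
    size₃ = trans
      (insert-size W₂ (home l₂) (trans (lookup∘update′ (x₁≢x₂ ∘ sym) W₁ _)
        (trans (lookup∘update′ (≢home r ∘ sym) W₀ _) (W₀-nothing v₂))))
      (cong suc (trans
        (insert-size W₁ (home l₁) (trans (lookup∘update′ x₁≢p W₀ _) (W₀-nothing v₁)))
        (cong suc (trans
          (insert-size W₀ (partner r) (unmatched r))
          (cong suc (trans (weaken-size (weaken W)) (weaken-size W)))))))
    size-M : size (matching S₂) ≡ suc (size (matching S))
    size-M = trans (weaken-size (matching S₁)) (trans
      (insert-size (weaken (matching S) [ home l₁ ]≔ just zero) i
        (trans (lookup∘update′ (x₁≢i ∘ sym) (weaken (matching S)) _) (weaken-nothing (matching S) Mi)))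
      (cong suc (trans
        (overwrite-size (weaken (matching S)) (home l₁) (weaken-just (matching S) (matched v₁)))
        (weaken-size (matching S)))))
    x₁-matched : lookup (matching S₂) (home l₁) ≡ just (suc zero)
    x₁-matched = weaken-just (matching S₁) (trans
      (lookup∘update′ x₁≢i (weaken (matching S) [ _ ]≔ _) _)
      (lookup∘update (home l₁) (weaken (matching S)) _))
    keep₁ : Valid h₂ S₂ W₃ (shift (moved i l₁))
    -- The edge of j′ lies in the block of `l₁` itself, at a vertex that M now matches to j. The
    -- other two edges lie in the block of `l₂`.
    keep₁ = valid-insert-elsewhere
      (valid-insert
        (valid-insert-elsewhere (valid-arrive (valid-move v₁ i∈b Mi) (λ _ → refl) refl)
          (b₁≢b₂ ∘ sym ∘ trans (sym (∈block r)))
          (vertices-distinct v₂ v₁ (b₁≢b₂ ∘ sym) ∘ Fin.suc-injective ∘ Fin.suc-injective))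
        (λ _ eq → case trans (sym x₁-matched) eq of λ ()) x₁≢i λ ())
      (b₁≢b₂ ∘ sym ∘ trans (sym (blk-home v₂))) λ ()
    keep : ∀ {l} → Apart l₁ l × (Apart l₂ l × Valid h S W l) → Valid h₂ S₂ W₃ (shift (shift l))
    keep (b₁≢ , b₂≢ , v) = valid-insert-elsewhere
      (valid-insert-elsewhere
        (valid-insert-elsewhere (elsewhere b₁≢ v) (b₂≢ ∘ trans (sym (∈block r)))
          (vertices-distinct v₂ v b₂≢ ∘ Fin.suc-injective ∘ Fin.suc-injective))
        (b₁≢ ∘ trans (sym (blk-home v₁))) λ ())
      (b₂≢ ∘ trans (sym (blk-home v₂))) λ ()

  -- Opening the blocks in increasing order.

  Fresh : ℕ → State V m → Pairing V m → Set
  Fresh c S W = ∀ {i} → c ≤ toℕ (blk i) → lookup (matching S) i ≡ nothing × lookup W i ≡ nothing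

  -- The home of a live vertex is matched, whereas a fresh block contains no matched vertex.
  fresh-apart : ∀ {b} {h : History V m} {S W ls} → Fresh (toℕ b) S W → All (Valid h S W) ls →
                All (λ l → b ≢ index l) ls
  fresh-apart fresh = All.map λ { v refl →
    case trans (sym (matched v)) (proj₁ (fresh (≤-reflexive (cong toℕ (sym (blk-home v)))))) of λ () }

  fresh-step : ∀ {c x} (S : State V m) {S′ : State V (suc m)} W W′ → Fresh c S W → toℕ (blk x) ≡ c →
               (∀ {i} → i ≢ x → lookup (matching S′) i ≡ lookup (weaken (matching S)) i) →
               (∀ {i} → i ≢ x → lookup W′ i ≡ lookup (weaken W) i) →
               Fresh (suc c) S′ W′
  fresh-step {x = x} S W W′ fresh blk-x M-eq W-eq {i} c<blk with i Fin.≟ x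
  ... | yes refl = contradiction blk-x (>⇒≢ c<blk)
  ... | no  i≢x  =
    trans (M-eq i≢x) (weaken-nothing (matching S) (proj₁ (fresh (<⇒≤ c<blk)))) ,
    trans (W-eq i≢x) (weaken-nothing W (proj₂ (fresh (<⇒≤ c<blk))))

  -- W takes the skipped vertex at once, with an arbitrary vertex of its block, here the first. The
  -- vertex never becomes live.
  open-skip : ∀ b {h : History V m} {S W ls} → Config h S W ls → Fresh (toℕ b) S W →
              ∃ λ W′ → Config (block b ∷ h) (apply skip S) W′ (List.map shift ls)
                     × Fresh (suc (toℕ b)) (apply skip S) W′ × size W′ ≡ 1 + size W
  open-skip b {h} {S} {W} {ls} c fresh = W₁ , record
    { isMatching = insert-isMatching (block b ∷ h) (weaken W)
        (weaken-isMatching (block b) h W (isMatching c)) (weaken-zero-unmatched W) (∈-block⁺ blk-x)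
    ; valid      = All.map⁺ (All.zipWith
        (λ { (b≢ , v) → valid-insert-elsewhere (valid-arrive v (λ _ → refl) refl)
                          (b≢ ∘ trans (sym blk-x)) λ () })
        (fresh-apart fresh (valid c) , valid c))
    ; apart      = AllPairs.map⁺ (apart c)
    ; potential  = subst₂ (λ μ ρ → α * μ ≤ ρ) (sym (weaken-size (matching S)))
        (cong₂ (λ w ρ → β * w + ρ) (sym size₁) (sym (total-shift ls)))
        (≤-trans (potential c) (+-monoˡ-≤ (total ls) (*-monoʳ-≤ β (n≤1+n (size W)))))
    } , fresh-step S {apply skip S} W W₁ fresh (cong toℕ blk-x) (λ _ → refl) (λ i≢x → lookup∘update′ i≢x (weaken W) _)
      , size₁
    where
    x     = combine {B} {width} b zero
    blk-x = blk-combine b zero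
    W₁    = weaken W [ x ]≔ just zero
    size₁ : size W₁ ≡ suc (size W)
    size₁ = trans (insert-size (weaken W) x (weaken-nothing W
        (proj₂ (fresh (≤-reflexive (cong toℕ (sym blk-x)))))))
      (cong suc (weaken-size W))

  open-match : ∀ {b} {h : History V m} {S W ls x} → Config h S W ls → Fresh (toℕ b) S W → blk x ≡ b →
               Config (block b ∷ h) (apply (path₁ x) S) (weaken W) (live b [] x zero ∷ List.map shift ls)
               × Fresh (suc (toℕ b)) (apply (path₁ x) S) (weaken W)
  open-match {b = b} {h} {S} {W} {ls} {x} c fresh blk-x = record
    { isMatching = weaken-isMatching (block b) h W (isMatching c)
    ; valid      = new ∷ All.map⁺ (All.zipWith
        (λ { (b≢ , v) → valid-arrive v
               (λ i∈b → lookup∘update′ (λ { refl → b≢ (trans (sym blk-x) i∈b) }) (weaken (matching S)) _) refl })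
        (apart-new , valid c))
    ; apart      = All.map⁺ apart-new ∷ AllPairs.map⁺ (apart c)
    ; potential  = subst₂ (λ μ ρ → α * μ ≤ ρ)
        (sym (trans (insert-size (weaken (matching S)) x (weaken-nothing (matching S) (proj₁ (untouched blk-x))))
                    (cong suc (weaken-size (matching S)))))
        (cong₂ (λ w ρ → β * w + (φ 0 + ρ)) (sym (weaken-size W)) (sym (total-shift ls)))
        bound
    } , fresh-step S {apply (path₁ x) S} W (weaken W) fresh (cong toℕ blk-x)
        (λ i≢x → lookup∘update′ i≢x (weaken (matching S)) _) (λ _ → refl)
    where
    apart-new = fresh-apart fresh (valid c)
    untouched : ∀ {i} → blk i ≡ b → lookup (matching S) i ≡ nothing × lookup W i ≡ nothing
    untouched i∈b = fresh (≤-reflexive (cong toℕ (sym i∈b)))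
    new : Valid (block b ∷ h) (apply (path₁ x) S) (weaken W) (live b [] x zero)
    new = record
      { nbrs⁻    = ∈-block⁻
      ; nbrs⁺    = ∈-block⁺
      ; matched  = lookup∘update x (weaken (matching S)) _
      ; moves    = refl
      ; blk-home = blk-x
      ; vertex∉W = weaken-zero-unmatched W
      ; home∉W   = weaken-nothing W (proj₂ (untouched blk-x))
      ; unused   = λ i∈b i∉ → trans (lookup∘update′ (λ { refl → i∉ (here refl) }) (weaken (matching S)) _)
                                    (weaken-nothing (matching S) (proj₁ (untouched i∈b)))
      ; W⊆M      = λ i∈b _ → weaken-nothing W (proj₂ (untouched i∈b))
      }
    bound : α * suc (size (matching S)) ≤ β * size W + (φ 0 + total ls)
    bound = begin
      α * suc (size (matching S))          ≡⟨ *-suc α _ ⟩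
      α + α * size (matching S)            ≤⟨ +-monoʳ-≤ α (potential c) ⟩
      α + (β * size W + total ls)          ≡⟨ cong (_+ (β * size W + total ls)) φ0≡α ⟨
      φ 0 + (β * size W + total ls)        ≡⟨ lemma (φ 0) (β * size W) (total ls) ⟩
      β * size W + (φ 0 + total ls)        ∎
      where
      open ≤-Reasoning
      lemma : ∀ a b c → a + (b + c) ≡ b + (a + c)
      lemma = solve-∀

  config-resp-↭ : ∀ {h : History V m} {S W ls ls′} → ls ↭ ls′ → Config h S W ls → Config h S W ls′
  config-resp-↭ {h = h} {S} {W} p c = record
    { isMatching = isMatching c
    ; valid      = Perm.All-resp-↭ p (valid c)
    ; apart      = AllPairs-resp (apart c) p
    ; potential  = subst (λ ρ → α * size (matching S) ≤ β * size W + ρ)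
        (sum-↭ (Perm.map⁺ (φ ∘ level) p)) (potential c)
    }
    where
    AllPairs-resp : ∀ {xs ys : List (Live _)} → AllPairs Apart xs → xs ↭ ys → AllPairs Apart ys
    AllPairs-resp a                         Perm.refl         = a
    AllPairs-resp (px ∷ a)                  (Perm.prep _ p)   = Perm.All-resp-↭ p px ∷ AllPairs-resp a p
    -- Exchanging two entries uses the symmetry of `Apart`.
    AllPairs-resp ((xy ∷ px) ∷ py ∷ a)      (Perm.swap _ _ p) =
      (xy ∘ sym ∷ Perm.All-resp-↭ p py) ∷ Perm.All-resp-↭ p px ∷ AllPairs-resp a p
    AllPairs-resp a                         (Perm.trans p q)  = AllPairs-resp (AllPairs-resp a p) q

  -- The only neighbour of the new vertex is matched to a vertex whose own
  -- neighbours are all matched.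
  forced-skip : ∀ {x} {N : Subset V} {h : History V m} {S} → lookup (matching S) x ≡ just zero →
                (∀ {i} → i ∈ N → lookup (matching S) i ≢ nothing) →
                ∀ {mv} → IsAugmenting ⁅ x ⁆ (N ∷ h) S mv → skip ≡ mv
  forced-skip Mx closed {skip} _ = refl
  forced-skip {x = x} Mx closed {path₁ i} (i∈ , Mi) with x∈⁅y⁆⇒x≡y x i∈
  ... | refl = case trans (sym Mx) Mi of λ ()
  forced-skip {x = x} Mx closed {path₃ x′ y i} (x′∈ , Mx′ , i∈y , Mi)
    with x∈⁅y⁆⇒x≡y x x′∈
  ... | refl with trans (sym Mx) Mx′
  ... | refl = contradiction Mi (closed i∈y)

  -- The play against an arbitrary algorithm.

  module _ {s : ℕ∞} (A : OMP₃ s (fin t)) where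
    open OMP₃ A

    level≤t : ∀ (h : History V m) {W l} → Valid h (run strategy h) W l → level l ≤ t
    level≤t h {l = l} v = subst (_≤ t) (moves v) ([≤]-injective (budgetR h (vertex l)))

    -- There are c blocks in play; each is live or contributes an edge to the
    -- reference matching.
    record Position (c k : ℕ) : Set where
      constructor position
      field
        {arrived}  : ℕ
        history    : History V arrived
        {W}        : Pairing V arrived
        {ls}       : List (Live arrived)
        config     : Config history (run strategy history) W ls
        covered    : c ≤ size W + length ls
        few        : length ls ≤ k

    opening : ∀ c → c ≤ B → ∃ λ k → ∃ λ (P : Position c k) →
              Fresh c (run strategy (Position.history P)) (Position.W P)
    opening zero    _   = 0 , position [] {Vec.replicate V nothing} {[]} start z≤n z≤n ,
      λ {i} _ → lookup-replicate i nothing , lookup-replicate i nothing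
      where
      empty : size (Vec.replicate {A = Maybe (Fin 0)} V nothing) ≡ 0
      empty = trans (cong ∣_∣ (map-replicate is-just nothing V)) (∣⊥∣≡0 V)
      start : Config [] initial (Vec.replicate V nothing) []
      start = record
        { isMatching = (λ { _ () }) , (λ { _ _ () })
        ; valid      = []
        ; apart      = []
        ; potential  = ≤-trans (≤-reflexive (trans (cong (α *_) empty) (*-zeroʳ α))) z≤n
        }
    opening (suc c) c<B with opening c (<⇒≤ c<B)
    ... | k , position {m} h {W} {ls} config covered few , fresh =
      -- The move travels with an equation, so that the case analysis on it does not disturb
      -- `run strategy`.
      respond (strategy (block b ∷ h)) refl (augmenting (block b) h)
      where
      S = run strategy h
      b = fromℕ< c<B
      toℕb≡c : toℕ b ≡ c
      toℕb≡c = Fin.toℕ-fromℕ< c<B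
      fresh-b : Fresh (toℕ b) S W
      fresh-b p = fresh (subst (_≤ _) toℕb≡c p)
      Goal = ∃ λ k → ∃ λ (P : Position (suc c) k) →
             Fresh (suc c) (run strategy (Position.history P)) (Position.W P)
      finish : ∀ {mv W′ ls′} → mv ≡ strategy (block b ∷ h) →
        Config (block b ∷ h) (apply mv S) W′ ls′ → Fresh (suc (toℕ b)) (apply mv S) W′ →
        suc c ≤ size W′ + length ls′ → Goal
      finish refl c′ f′ cov = _ , position (block b ∷ h) c′ cov ≤-refl ,
        λ p → f′ (subst (λ z → suc z ≤ _) (sym toℕb≡c) p)
      respond : ∀ mv → mv ≡ strategy (block b ∷ h) → IsAugmenting (block b) h S mv → Goal
      respond skip eq _ with open-skip b config fresh-b
      ... | W′ , c′ , f′ , sizeW′ = finish eq c′ f′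
        (subst₂ (λ w l → suc c ≤ w + l) (sym sizeW′) (sym (length-map shift ls)) (s≤s covered))
      respond (path₁ x) eq (x∈b , _) with open-match config fresh-b (∈-block⁻ x∈b)
      ... | c′ , f′ = finish eq c′ f′
        (subst₂ (λ w l → suc c ≤ w + suc l) (sym (weaken-size W)) (sym (length-map shift ls))
          (subst (suc c ≤_) (sym (+-suc _ _)) (s≤s covered)))
      -- A path of length 3 would pass through a matched vertex of the fresh block.
      respond (path₃ x y i) eq (x∈b , Mx , _) =
        case trans (sym Mx) (proj₁ (fresh-b (≤-reflexive (cong toℕ (sym (∈-block⁻ x∈b)))))) of λ ()

    -- Levels take the t + 1 values from 0 to t, so among more than t + 1 live vertices two share a
    -- level. Their homes become the neighbours of the next arrival, and one of the two is retired.
    reduce-step : ∀ {c k} → suc t ≤ k → Position c (suc k) → Position c k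
    reduce-step {c} {k} t<k (position {m} h {W} {ls} config covered few) with length ls ≤? k
    ... | yes ∣ls∣≤k = position h config covered ∣ls∣≤k
    ... | no  ∣ls∣≰k
      with pigeonhole-↭ level ls (All.map (s≤s ∘ level≤t h) (valid config)) (≤-<-trans t<k (≰⇒> ∣ls∣≰k))
    ... | l₁ , l₂ , rest , p , same = respond (strategy (N ∷ h)) refl (augmenting N h)
      where
      S = run strategy h
      N = ⁅ home l₁ ⁆ ∪ ⁅ home l₂ ⁆
      config′ : Config h S W (l₁ ∷ l₂ ∷ rest)
      config′ = config-resp-↭ p config
      covered′ : c ≤ size W + (2 + length rest)
      covered′ = subst (λ z → c ≤ size W + z) (Perm.↭-length p) covered
      few′ : 1 + length rest ≤ k
      few′ = ≤-pred (subst (_≤ suc k) (Perm.↭-length p) few)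

      more : ∀ w r → w + (2 + r) ≡ 1 + w + (1 + r)
      more = solve-∀

      -- One live vertex is lost and W gains at least one edge, so `covered` survives. The surplus
      -- `d` is 1 after a skip and 2 after a move.
      finish : ∀ {m′} {h′ : History V m′} {W′ ls′} → Config h′ (run strategy h′) W′ ls′ →
               ∀ {d} → size W′ ≡ suc d + size W → length ls′ ≡ 1 + length rest → Position c k
      finish {h′ = h′} {W′} {ls′} c′ {d} sizeW′ length-ls′ = position h′ c′
        (≤-trans covered′ (≤-trans (≤-reflexive (more (size W) (length rest)))
          (≤-trans (+-monoˡ-≤ (1 + length rest) (s≤s (m≤n+m (size W) d)))
            (≤-reflexive (sym (cong₂ _+_ sizeW′ length-ls′))))))
        (subst (_≤ k) (sym length-ls′) few′)

      -- The algorithm may displace either vertex of the pair, so the argument is stated for both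
      -- orders; `l` is the displaced one.
      move : ∀ {x y i} l l′ → Config h S W (l ∷ l′ ∷ rest) → x ≡ home l → level l ≡ level l′ →
             (∀ {i} → i ∈ N → i ≡ home l ⊎ i ≡ home l′) → home l′ ∈ N →
             lookup (matching S) x ≡ just y → i ∈ lookup h y → lookup (matching S) i ≡ nothing →
             path₃ x y i ≡ strategy (N ∷ h) → Position c k
      move {y = y} {i} l l′ cfg refl same ∈N⁻ l′∈N Mx i∈y Mi eq with valid cfg | apart cfg
      ... | v ∷ v′ ∷ _ | (b≢ ∷ _) ∷ _ with trans (sym Mx) (matched v)
      ... | refl with move-step {N = N} {N′ = ⁅ home l ⁆} cfg l′∈N (x∈⁅x⁆ _) (nbrs⁻ v i∈y) Mi same (level≤t h v′)
      ... | W′ , c′ , sizeW′ = finish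
        (subst (λ S → Config (⁅ home l ⁆ ∷ N ∷ h) S W′ (shift (moved i l) ∷ List.map (shift ∘ shift) rest))
          state-eq c′)
        sizeW′
        (cong suc (length-map (shift ∘ shift) rest))
        where
        S₁ = apply (path₃ (home l) y i) S
        x≢i : home l ≢ i
        x≢i refl = case trans (sym Mx) Mi of λ ()
        Mx′ : lookup (matching S₁) (home l) ≡ just zero
        Mx′ = trans (lookup∘update′ x≢i (weaken (matching S) [ _ ]≔ _) _) (lookup∘update (home l) (weaken (matching S)) _)
        l′-matched : lookup (matching S₁) (home l′) ≡ just (suc (vertex l′))
        l′-matched = trans
          (lookup∘update′ (λ { refl → case trans (sym (matched v′)) Mi of λ () }) (weaken (matching S) [ _ ]≔ _) _)
          (trans (lookup∘update′
              (λ eq → b≢ (trans (sym (blk-home v)) (trans (cong blk (sym eq)) (blk-home v′))))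
              (weaken (matching S)) _)
            (weaken-just (matching S) (matched v′)))
        -- The neighbours of j are the two homes: one is now matched to j itself, the other still to
        -- its live vertex.
        closed : ∀ {i′} → i′ ∈ N → lookup (matching S₁) i′ ≢ nothing
        closed i′∈N none with ∈N⁻ i′∈N
        ... | inj₁ refl = case trans (sym Mx′) none of λ ()
        ... | inj₂ refl = case trans (sym l′-matched) none of λ ()
        skips : skip ≡ strategy (⁅ home l ⁆ ∷ N ∷ h)
        skips = forced-skip Mx′ closed
          (subst (λ mv → IsAugmenting ⁅ home l ⁆ (N ∷ h) (apply mv S) (strategy (⁅ home l ⁆ ∷ N ∷ h)))
            (sym eq) (augmenting ⁅ home l ⁆ (N ∷ h)))
        state-eq : apply skip S₁ ≡ run strategy (⁅ home l ⁆ ∷ N ∷ h)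
        state-eq = cong₂ apply skips (cong (λ mv → apply mv S) eq)

      ∈N⁻ : ∀ {i} → i ∈ N → i ≡ home l₁ ⊎ i ≡ home l₂
      ∈N⁻ i∈N with x∈p∪q⁻ ⁅ home l₁ ⁆ ⁅ home l₂ ⁆ i∈N
      ... | inj₁ i∈ = inj₁ (x∈⁅y⁆⇒x≡y (home l₁) i∈)
      ... | inj₂ i∈ = inj₂ (x∈⁅y⁆⇒x≡y (home l₂) i∈)
      x₁∈N : home l₁ ∈ N
      x₁∈N = x∈p∪q⁺ (inj₁ (x∈⁅x⁆ _))
      x₂∈N : home l₂ ∈ N
      x₂∈N = x∈p∪q⁺ {p = ⁅ home l₁ ⁆} (inj₂ (x∈⁅x⁆ _))

      respond : ∀ mv → mv ≡ strategy (N ∷ h) → IsAugmenting N h S mv → Position c k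
      respond skip eq _ with skip-step {N = N} config′ x₁∈N (level≤t h (All.head (valid config′)))
      ... | W′ , c′ , sizeW′ = finish
        (subst (λ mv → Config (N ∷ h) (apply mv S) W′ (List.map shift (l₂ ∷ rest))) eq c′)
        sizeW′ (cong suc (length-map shift rest))
      respond (path₁ i) eq (i∈N , Mi) with ∈N⁻ i∈N | valid config′
      ... | inj₁ refl | v₁ ∷ _      = case trans (sym (matched v₁)) Mi of λ ()
      ... | inj₂ refl | _ ∷ v₂ ∷ _  = case trans (sym (matched v₂)) Mi of λ ()
      respond (path₃ x y i) eq (x∈N , Mx , i∈y , Mi) with ∈N⁻ x∈N
      ... | inj₁ x≡ = move l₁ l₂ config′ x≡ same ∈N⁻ x₂∈N Mx i∈y Mi eq
      ... | inj₂ x≡ = move l₂ l₁ (config-resp-↭ (swap _ _ ↭-refl) config′) x≡ (sym same)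
                        (Sum.swap ∘ ∈N⁻) x₁∈N Mx i∈y Mi eq

    reduce : ∀ {c} k → Position c k → Position c (suc t)
    reduce k P with k ≤? suc t
    reduce k       (position h c cov few) | yes k≤t+1 = position h c cov (≤-trans few k≤t+1)
    reduce zero    P | no  0≰t+1 = contradiction z≤n 0≰t+1
    reduce (suc k) P | no  k≰t   = reduce k (reduce-step (≤-pred (≰⇒> k≰t)) P)

    -- At most t + 1 vertices remain live, each of weight at most 2β, so the additive term does not
    -- depend on `B`.
    adversary : ∃ λ m → ∃ λ (h : History V m) → ∃ λ W → IsMatching (graph h) W
                × B ≤ size W + suc t
                × α * size (matching (run strategy h)) ≤ β * size W + suc t * (β * 2)
    adversary with opening B ≤-refl
    ... | k , P , _ with reduce k P
    ... | position h {W} {ls} c covered few = _ , h , W , isMatching c ,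
      ≤-trans covered (+-monoʳ-≤ (size W) few) ,
      ≤-trans (potential c) (+-monoʳ-≤ (β * size W)
        (≤-trans (total≤ (All.map (level≤t h) (valid c))) (*-monoˡ-≤ (β * 2) few)))
      where
      total≤ : ∀ {ls : List (Live m)} → All (λ l → level l ≤ t) ls → total ls ≤ length ls * (β * 2)
      total≤ []         = z≤n
      total≤ (l≤t ∷ ps) = +-mono-≤ (φ≤2β l≤t) (total≤ ps)

-- Instances and competitive ratios

opposite-inject₁ : ∀ (i : Fin n) → opposite (Fin.inject₁ i) ≡ suc (opposite i)
opposite-inject₁ zero    = refl
opposite-inject₁ (suc i) = cong Fin.inject₁ (opposite-inject₁ i)

opposite-fromℕ : ∀ n → opposite (Fin.fromℕ n) ≡ zero
opposite-fromℕ zero    = refl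
opposite-fromℕ (suc n) = cong Fin.inject₁ (opposite-fromℕ n)

tabulate-∷ʳ : (f : Fin (suc n) → A) → tabulate f ≡ tabulate (f ∘ Fin.inject₁) Vec.∷ʳ f (Fin.fromℕ n)
tabulate-∷ʳ {n = zero}  f = refl
tabulate-∷ʳ {n = suc n} f = cong (f zero ∷_) (tabulate-∷ʳ (f ∘ suc))

tabulate-opposite : (xs : Vec A n) → tabulate (lookup xs ∘ opposite) ≡ reverse xs
tabulate-opposite []       = refl
tabulate-opposite {n = suc n} (x ∷ xs) = begin
  tabulate (lookup (x ∷ xs) ∘ opposite)
    ≡⟨ tabulate-∷ʳ (lookup (x ∷ xs) ∘ opposite) ⟩
  tabulate (lookup (x ∷ xs) ∘ opposite ∘ Fin.inject₁) Vec.∷ʳ lookup (x ∷ xs) (opposite (Fin.fromℕ n))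
    ≡⟨ cong₂ Vec._∷ʳ_ (tabulate-cong (cong (lookup (x ∷ xs)) ∘ opposite-inject₁))
                      (cong (lookup (x ∷ xs)) (opposite-fromℕ n)) ⟩
  tabulate (lookup xs ∘ opposite) Vec.∷ʳ x  ≡⟨ cong (Vec._∷ʳ x) (tabulate-opposite xs) ⟩
  reverse xs Vec.∷ʳ x                       ≡⟨ reverse-∷ x xs ⟨
  reverse (x ∷ xs)                          ∎
  where open ≡-Reasoning

-- A history lists the latest arrival first.
instanceOf : History n m → Instance
instanceOf h = record { G = graph h ; π = Permutation.reverse }

-- `revealed` reverses the arrival order, which is itself the reversal of `h`.
revealed-instanceOf : (h : History n m) → revealed (instanceOf h) ≡ h
revealed-instanceOf h = trans (cong reverse (tabulate-opposite h)) (reverse-involutive h)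

-- For an undecided predicate the maximum is obtained under double negation, which suffices for
-- refuting a claim. The induction is on the gap `d` between a witness and the bound: a larger
-- witness narrows it.
¬¬-maximum : ∀ {P : ℕ → Set} d {k} → P k → (∀ {j} → P j → j ≤ d + k) →
             ¬ ¬ (∃ λ k → P k × (∀ {j} → P j → j ≤ k))
¬¬-maximum zero    Pk bound none = none (_ , Pk , bound)
¬¬-maximum (suc d) {k} Pk bound none = none (k , Pk , λ {j} Pj → case j ≤? k of λ
  { (yes j≤k) → j≤k
  ; (no  j≰k) → contradiction none (¬¬-maximum d Pj λ Pi →
      ≤-trans (bound Pi) (≤-trans (≤-reflexive (sym (+-suc d k))) (+-monoʳ-≤ d (≰⇒> j≰k)))) })

¬¬-matchingNumber : ∀ (h : History n m) W → IsMatching (graph h) W →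
                    ¬ ¬ (∃ λ k → IsMatchingNumber (graph h) k)
¬¬-matchingNumber {n} h W isM none = ¬¬-maximum
  {P = λ k → ∃[ M ] IsMatching (graph h) M × size M ≡ k} n {size W} (W , isM , refl)
  (λ { (M , _ , refl) → ≤-trans (∣p∣≤n (Vec.map is-just M)) (m≤m+n n (size W)) })
  λ { (k , attained , bound) → none (k , attained , λ M isM → bound (M , isM , refl)) }

-- Since ρ exceeds the nonnegative a / b, its numerator is a natural number, and all comparisons can
-- be multiplied out over ℕ.
clear-denominators : ∀ {a b ρ} .{{_ : NonZero b}} → (+ a ℚ./ b) ℚ.< ρ →
  ∃₂ λ p q → a * q < p * b × (∀ k l → ρ ℚ.* fromℕ k ℚ.≤ fromℕ l → p * k ≤ l * q)
clear-denominators {a} {suc b} {ρ@(mkℚ r d _)} γ<ρ = split r refl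
  where
  lower : + a ℤ.* + suc d ℤ.< r ℤ.* + suc b
  lower = ℚᵘ.drop-*<* (ℚᵘ.<-respˡ-≃ (ℚ.toℚᵘ-fromℚᵘ (mkℚᵘ (+ a) b)) (ℚ.toℚᵘ-mono-< γ<ρ))
  upper : ∀ {k l} → ρ ℚ.* fromℕ k ℚ.≤ fromℕ l → (r ℤ.* + k) ℤ.* + 1 ℤ.≤ + l ℤ.* + (suc d * 1)
  upper {k} {l} ρk≤l = ℚᵘ.drop-*≤* (ℚᵘ.≤-respˡ-≃
    (ℚᵘ.≃-trans (ℚ.toℚᵘ-homo-* ρ (fromℕ k)) (ℚᵘ.*-congˡ {toℚᵘ ρ} (ℚ.toℚᵘ-fromℚᵘ (mkℚᵘ (+ k) 0))))
    (ℚᵘ.≤-respʳ-≃ (ℚ.toℚᵘ-fromℚᵘ (mkℚᵘ (+ l) 0)) (ℚ.toℚᵘ-mono-≤ ρk≤l)))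
  split : ∀ r′ → r ≡ r′ →
    ∃₂ λ p q → a * q < p * suc b × (∀ k l → ρ ℚ.* fromℕ k ℚ.≤ fromℕ l → p * k ≤ l * q)
  split (+ p) refl = p , suc d ,
    ℤ.drop‿+<+ (subst₂ ℤ._<_ (sym (ℤ.pos-* a (suc d))) (sym (ℤ.pos-* p (suc b))) lower) ,
    λ k l ρk≤l → ℤ.drop‿+≤+ (subst₂ ℤ._≤_
      (trans (ℤ.*-identityʳ _) (sym (ℤ.pos-* p k)))
      (trans (cong (λ z → + l ℤ.* + z) (*-identityʳ (suc d))) (sym (ℤ.pos-* l (suc d))))
      (upper {k} {l} ρk≤l))
  split -[1+ p ] refl = case subst (ℤ._< -[1+ p ] ℤ.* + suc b) (sym (ℤ.pos-* a (suc d))) lower of λ ()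

-- Over ℕ the strict inequality says βq + 1 ≤ pα. Multiplied by w, this surplus of 1 leaves a bare w
-- against C q, so a ratio above β / α bounds the reference matching by a constant.
bounded-reference : ∀ {α β C p q w ν μ} → β * q < p * α → w ≤ ν → p * ν ≤ μ * q →
                    α * μ ≤ β * w + C → w ≤ C * q
bounded-reference {α} {β} {C} {p} {q} {w} {ν} {μ} βq<pα w≤ν pν≤μq potential =
  +-cancelˡ-≤ (β * q * w) w (C * q) (begin
    β * q * w + w         ≡⟨ +-comm (β * q * w) w ⟩
    suc (β * q) * w       ≤⟨ *-mono-≤ βq<pα w≤ν ⟩
    p * α * ν             ≡⟨ e₁ p α ν ⟩
    α * (p * ν)           ≤⟨ *-monoʳ-≤ α pν≤μq ⟩
    α * (μ * q)           ≡⟨ *-assoc α μ q ⟨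
    α * μ * q             ≤⟨ *-monoˡ-≤ q potential ⟩
    (β * w + C) * q       ≡⟨ e₂ β w C q ⟩
    β * q * w + C * q     ∎)
  where
  open ≤-Reasoning
  e₁ : ∀ p α ν → p * α * ν ≡ α * (p * ν)
  e₁ = solve-∀
  e₂ : ∀ β w C q → (β * w + C) * q ≡ β * q * w + C * q
  e₂ = solve-∀

theorem19 : ∀ (t : ℕ) → 1 ≤ t → (s : ℕ∞) → fin 1 ≤⁺ s →
    (A : OMP₃ s (fin t)) → ¬ CompetitiveRatioExceeds A (γ t)
theorem19 t _ s _ A (ρ , γ<ρ , competitive) = refute (clear-denominators {β′} {α′} γ<ρ)
  where
  open Potential t
  α′ β′ C : ℕ
  α′ = 3 * 2 ^ t ∸ 1
  β′ = 2 * 2 ^ t ∸ 1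
  C  = suc t * (β * 2)

  α′≡α : α′ ≡ α
  α′≡α = trans (cong (λ z → 3 * z ∸ 1) (sym 1+[2^t∸1]≡2^t)) (lemma (2 ^ t ∸ 1))
    where
    -- The left side is what `3 * suc τ ∸ 1` computes to.
    lemma : ∀ τ → τ + (suc τ + (suc τ + 0)) ≡ 3 * τ + 2
    lemma = solve-∀

  β′≡β : β′ ≡ β
  β′≡β = trans (cong (λ z → 2 * z ∸ 1) (sym 1+[2^t∸1]≡2^t)) (lemma (2 ^ t ∸ 1))
    where
    lemma : ∀ τ → τ + (suc τ + 0) ≡ 2 * τ + 1
    lemma = solve-∀

  instance
    α′≢0 : NonZero α′
    α′≢0 = >-nonZero (subst (0 <_) (sym α′≡α) (m≤n⇒m≤o+n (3 * (2 ^ t ∸ 1)) (s≤s z≤n)))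

  refute : ¬ (∃₂ λ p q → β′ * q < p * α′ × (∀ k l → ρ ℚ.* fromℕ k ℚ.≤ fromℕ l → p * k ≤ l * q))
  -- With this many blocks, all but at most t + 1 of them accounted for by W, the size of W must
  -- exceed `C * q`.
  refute (p , q , β′q<pα′ , scaled) = against (Blocks.adversary t (suc (C * q + suc t)) A)
    where
    against : ∀ {n} → ¬ (∃ λ m → ∃ λ (h : History n m) → ∃ λ W → IsMatching (graph h) W
              × suc (C * q + suc t) ≤ size W + suc t
              × α * size (matching (run (OMP₃.strategy A) h)) ≤ β * size W + C)
    against (m , h , W , isM , covered , potential) = ¬¬-matchingNumber h W isM λ (ν , isν) →
      contradiction (+-monoˡ-≤ (suc t) (bounded ν isν)) (<⇒≱ covered)
      where
      bounded : ∀ ν → IsMatchingNumber (graph h) ν → size W ≤ C * q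
      bounded ν isν = bounded-reference {α} {β} {C} {p} {q} {size W} {ν}
        (subst₂ (λ b a → b * q < p * a) β′≡β α′≡α β′q<pα′)
        (proj₂ isν W isM)
        (scaled ν (size (matching (run (OMP₃.strategy A) h)))
          (subst (λ h′ → ρ ℚ.* fromℕ ν ℚ.≤ fromℕ (size (matching (run (OMP₃.strategy A) h′))))
            (revealed-instanceOf h) (competitive (instanceOf h) ν isν)))
        potential
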